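{- For every $n\in\mathbb{N}_0$, every $\lambda\in\mathbb{N}$, and each $\mu\in\{0,\dots,\lambda\}$, we have $$OP_{\Pi_n,\operatorname{Aut}(\Pi_n)}(\lambda,\mu)=\frac12\left(P_{\Pi_n}(\lambda,\mu)+P_{\Pi_{n/2}}(\lambda,\mu)\right)$$ if $n$ is even, and $$OP_{\Pi_n,\operatorname{Aut}(\Pi_n)}(\lambda,\mu)=\frac12\left(P_{\Pi_n}(\lambda,\mu)+(\lambda-\mu)\,P_{\Pi_{(n-3)/2}}(\lambda,\mu)\right)$$ if $n$ is odd, where $\Pi_{ -1}$ is considered as the empty graph.
   Context: $\mathbb{N}$ denotes the positive integers and $\mathbb{N}_0=\mathbb{N}\cup\{0\}$. $\Pi_n$ is the path of length $n$, with vertex set $\{0,\dots,n\}$ and edge set $\{\{v,v+1\}\mid v=0,\dots,n-1\}$. $\operatorname{Aut}(\Gamma)$ is the automorphism group of a graph $\Gamma$, viewed as a group of permutations of the vertices. A $\lambda$-coloring of $\Gamma$ is a map $f$ from the vertex set of $\Gamma$ to $\{1,\dots,\lambda\}$; it is $\mu$-proper if for every pair of adjacent vertices $v,w$, either $f(v)\ne f(w)$ or $f(v)=f(w)>\mu$. $P_\Gamma(\lambda,\mu)$ is the number of $\mu$-proper $\lambda$-colorings of $\Gamma$ (so it equals $1$ for the empty graph). For a subgroup $G$ of $\operatorname{Aut}(\Gamma)$, $OP_{\Gamma,G}(\lambda,\mu)$ is the number of equivalence classes of $\mu$-proper $\lambda$-colorings of $\Gamma$, where $f$ and $f'$ are equivalent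 if $f'=f\circ g$ for some $g\in G$. -}

module Defs where

open import Data.Empty using (⊥)
open import Data.Fin using (Fin; zero; suc; toℕ; _≟_; punchIn; finToFun)
open import Data.Fin.Permutation using (Permutation′; _⟨$⟩ʳ_; _⟨$⟩ˡ_; _≈_; _∘ₚ_; flip; insert; remove; insert-remove; inverseʳ) renaming (id to idₚ)
open import Data.Fin.Properties using (all?; any?)
open import Data.Integer using (ℤ; +_; -[1+_])
open import Data.List using (List; map; filter; length; allFin; deduplicate)
open import Data.Nat using (ℕ; zero; suc; _^_; _>_; _>?_)
open import Data.Nat.Properties using (1+n≢n) renaming (_≟_ to _≟ℕ_)
open import Data.Product using (∃; ∃-syntax; _×_; _,_)
open import Data.Rational using (ℚ; _/_)
open import Data.Sum using (_⊎_; inj₁; inj₂; swap)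
open import Function using (_⇔_; mk⇔; Equivalence)
open import Function.Construct.Composition using (_⇔-∘_)
open import Function.Construct.Symmetry using (⇔-sym)
open import Level using (0ℓ)
open import Relation.Binary using (Rel; Decidable; Symmetric; Irreflexive; IsEquivalence)
open import Relation.Binary.PropositionalEquality using (_≡_; _≢_; refl; sym; trans; cong; subst₂)
open import Relation.Nullary using (Dec)
open import Relation.Nullary.Decidable using (map′; _⊎-dec_; _×-dec_; _→-dec_; ¬?)
open import Relation.Unary using (Pred) renaming (Decidable to Decidable₁)

record Graph : Set₁ where
  field
    order  : ℕ
    Adj    : Rel (Fin order) 0ℓ
    adj?   : Decidable Adj
    symm   : Symmetric Adj
    irrefl : Irreflexive _≡_ Adj

open Graph using (order; Adj; adj?)

path : ℕ → Graph
path n = record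
  { order  = suc n
  ; Adj    = λ v w → toℕ w ≡ suc (toℕ v) ⊎ toℕ v ≡ suc (toℕ w)
  ; adj?   = λ v w → (toℕ w ≟ℕ suc (toℕ v)) ⊎-dec (toℕ v ≟ℕ suc (toℕ w))
  ; symm   = swap
  ; irrefl = λ { refl (inj₁ p) → 1+n≢n (sym p) ; refl (inj₂ p) → 1+n≢n (sym p) }
  }

emptyGraph : Graph
emptyGraph = record
  { order  = 0
  ; Adj    = λ _ _ → ⊥
  ; adj?   = λ ()
  ; symm   = λ ()
  ; irrefl = λ _ ()
  }

-- The path of length ℓ. Only ℓ ≥ -1 is meaningful: Π (- 1) is the empty graph
-- by convention, and the values at ℓ < -1 are never used.

Π : ℤ → Graph
Π (+ n)    = path n
Π -[1+ _ ] = emptyGraph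

-- The element i of Fin l stands for the colour i + 1 of {1, …, l}.

Coloring : Graph → ℕ → Set
Coloring Γ l = Fin (order Γ) → Fin l

color : ∀ {l} → Fin l → ℕ
color c = suc (toℕ c)

Proper : ∀ Γ {l} (μ : ℕ) → Pred (Coloring Γ l) 0ℓ
Proper Γ μ f = ∀ v w → Adj Γ v w → f v ≢ f w ⊎ (f v ≡ f w × color (f v) > μ)

proper? : ∀ Γ {l} μ → Decidable₁ (Proper Γ {l} μ)
proper? Γ μ f = all? λ v → all? λ w → adj? Γ v w →-dec
  (¬? (f v ≟ f w) ⊎-dec ((f v ≟ f w) ×-dec (color (f v) >? μ)))

-- Every colouring occurs exactly once, up to pointwise equality.

colorings : ∀ Γ l → List (Coloring Γ l)
colorings Γ l = map finToFun (allFin (l ^ order Γ))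

properColorings : ∀ Γ l (μ : ℕ) → List (Coloring Γ l)
properColorings Γ l μ = filter (proper? Γ μ) (colorings Γ l)

P : Graph → ℕ → ℕ → ℕ
P Γ l μ = length (properColorings Γ l μ)

IsAutomorphism : ∀ Γ → Pred (Permutation′ (order Γ)) 0ℓ
IsAutomorphism Γ π = ∀ v w → Adj Γ v w ⇔ Adj Γ (π ⟨$⟩ʳ v) (π ⟨$⟩ʳ w)

-- Subgroups of the automorphism group, as decidable sets of permutations.
-- A permutation carries more data than its action on vertices, so membership
-- has to respect pointwise equality.

record Subgroup (Γ : Graph) : Set₁ where
  field
    Mem   : Pred (Permutation′ (order Γ)) 0ℓ
    mem?  : Decidable₁ Mem
    resp  : ∀ {π ρ} → π ≈ ρ → Mem π → Mem ρ
    isAut : ∀ {π} → Mem π → IsAutomorphism Γ π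
    id∈   : Mem idₚ
    ∘∈    : ∀ {π ρ} → Mem π → Mem ρ → Mem (π ∘ₚ ρ)
    ⁻¹∈   : ∀ {π} → Mem π → Mem (flip π)

Aut : ∀ Γ → Subgroup Γ
Aut Γ = record
  { Mem   = IsAutomorphism Γ
  ; mem?  = λ π → all? λ v → all? λ w →
      ⇔-dec (adj? Γ v w) (adj? Γ (π ⟨$⟩ʳ v) (π ⟨$⟩ʳ w))
  ; resp  = λ {π} {ρ} π≈ρ a v w → mk⇔
      (λ e → subst₂ (Adj Γ) (π≈ρ v) (π≈ρ w) (Equivalence.to (a v w) e))
      (λ e → Equivalence.from (a v w) (subst₂ (Adj Γ) (sym (π≈ρ v)) (sym (π≈ρ w)) e))
  ; isAut = λ a → a
  ; id∈   = λ v w → mk⇔ (λ e → e) (λ e → e)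
  ; ∘∈    = λ {π} {ρ} a b v w → b (π ⟨$⟩ʳ v) (π ⟨$⟩ʳ w) ⇔-∘ a v w
  ; ⁻¹∈   = λ {π} a v w → ⇔-sym (subst₂
      (λ x y → Adj Γ (π ⟨$⟩ˡ v) (π ⟨$⟩ˡ w) ⇔ Adj Γ x y)
      (inverseʳ π) (inverseʳ π) (a (π ⟨$⟩ˡ v) (π ⟨$⟩ˡ w)))
  }
  where
  ⇔-dec : {A B : Set} → Dec A → Dec B → Dec (A ⇔ B)
  ⇔-dec a? b? = map′ (λ (f , g) → mk⇔ f g) (λ e → Equivalence.to e , Equivalence.from e)
    ((a? →-dec b?) ×-dec (b? →-dec a?))

anyPermutation? : ∀ {n} {Q : Pred (Permutation′ n) 0ℓ} → Decidable₁ Q →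
                  (∀ {π ρ} → π ≈ ρ → Q π → Q ρ) → Dec (∃ Q)
anyPermutation? {zero} Q? resp =
  map′ (λ q → idₚ , q) (λ (_ , q) → resp (λ ()) q) (Q? idₚ)
anyPermutation? {suc n} Q? resp = map′
  (λ (j , π , q) → insert zero j π , q)
  (λ (π , q) → π ⟨$⟩ʳ zero , remove zero π ,
    resp (λ i → sym (insert-remove zero π i)) q)
  (any? λ j → anyPermutation? (λ π → Q? (insert zero j π))
    (λ {π} {ρ} π≈ρ → resp (insert-cong j {π} {ρ} π≈ρ)))
  where
  insert-cong : ∀ {n} j {π ρ : Permutation′ n} → π ≈ ρ → insert zero j π ≈ insert zero j ρ
  insert-cong j π≈ρ zero    = refl
  insert-cong j π≈ρ (suc i) = cong (punchIn j) (π≈ρ i)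

module _ (Γ : Graph) (G : Subgroup Γ) (l : ℕ) where
  open Subgroup G

  Equivalent : Rel (Coloring Γ l) 0ℓ
  Equivalent f f′ = ∃[ π ] Mem π × (∀ v → f′ v ≡ f (π ⟨$⟩ʳ v))

  equivalent? : Decidable Equivalent
  equivalent? f f′ = anyPermutation?
    (λ π → mem? π ×-dec all? (λ v → f′ v ≟ f (π ⟨$⟩ʳ v)))
    (λ π≈ρ (π∈ , eq) → resp π≈ρ π∈ , λ v → trans (eq v) (cong f (π≈ρ v)))

  isEquivalence : IsEquivalence Equivalent
  isEquivalence = record
    { refl  = idₚ , id∈ , λ _ → refl
    ; sym   = λ {f} (π , π∈ , eq) → flip π , ⁻¹∈ π∈ ,
        λ v → sym (trans (eq (π ⟨$⟩ˡ v)) (cong f (inverseʳ π)))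
    ; trans = λ (π , π∈ , eq) (ρ , ρ∈ , eq′) → ρ ∘ₚ π , ∘∈ ρ∈ π∈ ,
        λ v → trans (eq′ v) (eq (ρ ⟨$⟩ʳ v))
    }

-- As Equivalent is an equivalence relation, deduplicate keeps exactly one
-- representative of each class.

OP : ∀ Γ → Subgroup Γ → ℕ → ℕ → ℕ
OP Γ G l μ = length (deduplicate (equivalent? Γ G l) (properColorings Γ l μ))

fromℕ : ℕ → ℚ
fromℕ n = + n / 1

{-# OPTIONS --safe #-}

-- The automorphisms of a path are the identity and the reversal, so, as in
-- Burnside's lemma, twice the number of classes is the number of proper
-- colourings plus the number of proper palindromes. A palindrome is determined
-- by its half starting at the middle. For even n the half is any proper
-- colouring of the shorter path; for odd n the two middle vertices are adjacent
-- and share a colour, which must exceed μ, and a vertex with such a colour puts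
-- no constraint on its neighbours.

module Submission where

open import Defs
open import Data.Nat as ℕ using (ℕ; _≤_; _∸_)
open import Data.Nat.Divisibility using (_∣_)
open import Data.Integer as ℤ using (+_; _-_)
open import Data.Rational as ℚ using (½)
open import Data.Product using (_×_)
open import Relation.Nullary using (¬_)
open import Relation.Binary.PropositionalEquality using (_≡_)

open import Data.Fin as Fin using (Fin; zero; suc; toℕ; opposite; inject₁)
import Data.Fin.Permutation as Perm
open import Data.Fin.Permutation using (Permutation′; _⟨$⟩ʳ_)
import Data.Fin.Properties as Fin
import Data.Integer.DivMod as ℤ
import Data.Integer.Properties as ℤ
open import Data.List using (List; []; _∷_; _++_; length; filter; map; deduplicate; lookup; allFin; cartesianProductWith)
import Data.List.Membership.Setoid as Membership
import Data.List.Membership.Setoid.Properties as Membershipₚ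
open import Data.List.Properties using (length-++; length-map; length-tabulate)
import Data.List.Relation.Unary.AllPairs as AllPairs
open import Data.List.Relation.Unary.Any as Any using (here; there; index)
import Data.List.Relation.Unary.Unique.DecSetoid.Properties as DecUnique
open import Data.List.Relation.Unary.Unique.Setoid using (Unique)
import Data.List.Relation.Unary.Unique.Setoid.Properties as Unique
open import Data.Nat using (zero; suc; _+_; _*_; _<_; z≤n; s≤s; _>_)
open import Data.Nat.Divisibility using (divides)
import Data.Nat.DivMod as ℕ
import Data.Nat.Properties as ℕ
open import Data.Nat.Tactic.RingSolver using (solve-∀)
open import Data.Product using (∃-syntax; _,_; proj₂)
import Data.Rational.Properties as ℚ
import Data.Rational.Unnormalised as ℚᵘ
import Data.Rational.Unnormalised.Properties as ℚᵘ
open import Data.Sum using (_⊎_; inj₁; inj₂; [_,_]′)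
import Data.Sum as Sum
import Data.Vec.Functional as Vector
open import Function using (_∘_; _⇔_; Equivalence; Injection; mk⇔)
open import Function.Definitions using (Congruent; Injective)
open import Function.Properties.Inverse using (↔⇒↣)
open import Level using (Level)
open import Relation.Binary using (Rel; Setoid; DecSetoid; Decidable; IsEquivalence)
open import Relation.Binary.PropositionalEquality using (_≗_; refl; sym; trans; cong; cong₂; subst; subst₂; _→-setoid_; setoid; module ≡-Reasoning)
open import Relation.Nullary using (yes; no; contradiction)
open import Relation.Nullary.Decidable using (¬?)
open import Relation.Unary using (Pred) renaming (Decidable to Decidable₁)

private
  variable
    a b p r ℓ : Level

-- Sizes of lists without repetition.

length-filter-split : ∀ {A : Set a} {P : Pred A p} (P? : Decidable₁ P) xs →
                      length xs ≡ length (filter P? xs) + length (filter (¬? ∘ P?) xs)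
length-filter-split P? [] = refl
length-filter-split P? (x ∷ xs) with P? x
... | yes _ = cong suc (length-filter-split P? xs)
... | no  _ = trans (cong suc (length-filter-split P? xs)) (sym (ℕ.+-suc _ _))

length-cartesianProductWith : ∀ {A : Set a} {B : Set b} {C : Set p} (f : A → B → C) xs ys →
                              length (cartesianProductWith f xs ys) ≡ length xs * length ys
length-cartesianProductWith f []       ys = refl
length-cartesianProductWith f (x ∷ xs) ys = trans (length-++ (map (f x) ys))
  (cong₂ _+_ (length-map (f x) ys) (length-cartesianProductWith f xs ys))

module _ (S : Setoid a ℓ) where
  open Setoid S renaming (Carrier to A; refl to ≈-refl; sym to ≈-sym; trans to ≈-trans)
  open Membership S

  lookup-injective : ∀ {xs} → Unique S xs → Injective _≡_ _≈_ (lookup xs)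
  lookup-injective {_ ∷ _} _ {zero} {zero} _ = refl
  lookup-injective {x ∷ xs} (x≉ AllPairs.∷ _) {zero} {suc j} eq =
    contradiction (Membershipₚ.∈-resp-≈ S (≈-sym eq) (Membershipₚ.∈-lookup S xs j)) (Membershipₚ.All[≉]⇒∉ S x≉)
  lookup-injective {x ∷ xs} (x≉ AllPairs.∷ _) {suc i} {zero} eq =
    contradiction (Membershipₚ.∈-resp-≈ S eq (Membershipₚ.∈-lookup S xs i)) (Membershipₚ.All[≉]⇒∉ S x≉)
  lookup-injective {_ ∷ _} (_ AllPairs.∷ xs!) {suc i} {suc j} eq = cong suc (lookup-injective xs! eq)

  -- Sending each position of `xs` to the position of its entry in `ys` is an injection of finite
  -- index sets.
  Unique-⊆⇒length≤ : ∀ {xs ys} → Unique S xs → (∀ {x} → x ∈ xs → x ∈ ys) → length xs ≤ length ys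
  Unique-⊆⇒length≤ {xs} xs! xs⊆ys = Fin.injective⇒≤
    {f = λ i → index (xs⊆ys (Membershipₚ.∈-lookup S xs i))}
    (λ eq → lookup-injective xs! (Membershipₚ.index-injective S _ _ eq))

  Unique-⊆⊇⇒length≡ : ∀ {xs ys} → Unique S xs → Unique S ys →
                      (∀ {x} → x ∈ xs → x ∈ ys) → (∀ {x} → x ∈ ys → x ∈ xs) →
                      length xs ≡ length ys
  Unique-⊆⊇⇒length≡ xs! ys! xs⊆ys ys⊆xs =
    ℕ.≤-antisym (Unique-⊆⇒length≤ xs! xs⊆ys) (Unique-⊆⇒length≤ ys! ys⊆xs)

-- Orbits of an involution.

-- The orbit count for an involution σ: each class has one representative in the
-- deduplicated list ds, so the whole list is ds together with the σ-images of
-- its non-fixed elements, while ds contains every fixed element.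

module InvolutionOrbits {A : Set a} {_≈_ : Rel A ℓ} {_∼_ : Rel A r} (≈-equiv : IsEquivalence _≈_)
  (∼-equiv : IsEquivalence _∼_) (_∼?_ : Decidable _∼_)
  (σ : A → A) (σ-cong : Congruent _≈_ _≈_ σ) (σ-involutive : ∀ x → σ (σ x) ≈ x)
  (≈⇒∼ : ∀ {x y} → x ≈ y → x ∼ y) (x∼σx : ∀ x → x ∼ σ x)
  (∼⇒≈⊎σ : ∀ {x y} → x ∼ y → y ≈ x ⊎ y ≈ σ x)
  (fixed? : Decidable₁ (λ x → x ≈ σ x))
  where

  open IsEquivalence ≈-equiv renaming (refl to ≈-refl; sym to ≈-sym; trans to ≈-trans)
  private
    S : Setoid _ _
    S = record { isEquivalence = ≈-equiv }

    module ∼ = IsEquivalence ∼-equiv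
    open Membership S

    T : Setoid _ _
    T = record { isEquivalence = ∼-equiv }

    DT : DecSetoid _ _
    DT = record { isDecEquivalence = record { isEquivalence = ∼-equiv ; _≟_ = _∼?_ } }

    module ∈∼ = Membership T

    ∈⇒∈∼ : ∀ {x xs} → x ∈ xs → x ∈∼.∈ xs
    ∈⇒∈∼ = Any.map ≈⇒∼

    fixed-resp : ∀ {x y} → x ≈ y → x ≈ σ x → y ≈ σ y
    fixed-resp x≈y x≈σx = ≈-trans (≈-sym x≈y) (≈-trans x≈σx (σ-cong x≈y))

    nonfixed-resp : ∀ {x y} → x ≈ y → ¬ (x ≈ σ x) → ¬ (y ≈ σ y)
    nonfixed-resp x≈y ¬fix y≈σy = ¬fix (fixed-resp (≈-sym x≈y) y≈σy)

    σ-injective : ∀ {x y} → σ x ≈ σ y → x ≈ y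
    σ-injective eq = ≈-trans (≈-sym (σ-involutive _)) (≈-trans (σ-cong eq) (σ-involutive _))

  -- Entries at different positions are inequivalent, so both memberships must point at the same
  -- position.
  Unique-∼⇒≈ : ∀ {xs x y} → Unique T xs → x ∈ xs → y ∈ xs → x ∼ y → x ≈ y
  Unique-∼⇒≈ _ (here x≈) (here y≈) _ = ≈-trans x≈ (≈-sym y≈)
  Unique-∼⇒≈ (u≁ AllPairs.∷ _) (here x≈) (there y∈) x∼y = contradiction
    (Membershipₚ.∈-resp-≈ T (∼.trans (∼.sym x∼y) (≈⇒∼ x≈)) (∈⇒∈∼ y∈)) (Membershipₚ.All[≉]⇒∉ T u≁)
  Unique-∼⇒≈ (u≁ AllPairs.∷ _) (there x∈) (here y≈) x∼y = contradiction
    (Membershipₚ.∈-resp-≈ T (∼.trans x∼y (≈⇒∼ y≈)) (∈⇒∈∼ x∈)) (Membershipₚ.All[≉]⇒∉ T u≁)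
  Unique-∼⇒≈ (_ AllPairs.∷ xs!) (there x∈) (there y∈) x∼y = Unique-∼⇒≈ xs! x∈ y∈ x∼y

  orbit-count : ∀ {xs} → Unique S xs → (∀ {x} → x ∈ xs → σ x ∈ xs) →
                length (deduplicate _∼?_ xs) + length (deduplicate _∼?_ xs)
                  ≡ length xs + length (filter fixed? xs)
  orbit-count {xs} xs! closed = begin
    length ds + length ds
      ≡⟨ cong (λ z → length ds + z) (length-filter-split fixed? ds) ⟩
    length ds + (length (filter fixed? ds) + length free)
      ≡⟨ cong (λ z → length ds + z) (ℕ.+-comm (length (filter fixed? ds)) _) ⟩
    length ds + (length free + length (filter fixed? ds))
      ≡⟨ ℕ.+-assoc (length ds) _ _ ⟨
    length ds + length free + length (filter fixed? ds)
      ≡⟨ cong₂ _+_ xs-count fixed-count ⟨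
    length xs + length (filter fixed? xs) ∎
    where
    open ≡-Reasoning

    ds free : List A
    ds   = deduplicate _∼?_ xs
    free = filter (¬? ∘ fixed?) ds

    ds-∼! : Unique T ds
    ds-∼! = DecUnique.deduplicate-! DT xs

    ds! : Unique S ds
    ds! = AllPairs.map (λ x≁y x≈y → x≁y (≈⇒∼ x≈y)) ds-∼!

    ds⊆xs : ∀ {x} → x ∈ ds → x ∈ xs
    ds⊆xs = Membershipₚ.∈-deduplicate⁻ S _∼?_ xs

    representative : ∀ {x} → x ∈ xs → ∃[ d ] d ∈ ds × (x ≈ d ⊎ x ≈ σ d)
    representative x∈xs =
      let d , d∈ds , x∼d = find (Membershipₚ.∈-deduplicate⁺ T _∼?_ (λ y∼z x∼y → ∼.trans x∼y (∼.sym y∼z)) (∈⇒∈∼ x∈xs))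
      in d , d∈ds , ∼⇒≈⊎σ (∼.sym x∼d)

    xs-count : length xs ≡ length ds + length free
    xs-count = trans
      (Unique-⊆⊇⇒length≡ S xs!
        (Unique.++⁺ S ds! (Unique.map⁺ S S σ-injective (Unique.filter⁺ S _ ds!)) disjoint) to from)
      (trans (length-++ ds) (cong (λ z → length ds + z) (length-map σ free)))
      where
      disjoint : ∀ {v} → ¬ (v ∈ ds × v ∈ map σ free)
      disjoint (v∈ds , v∈σfree) =
        let d , d∈free , v≈σd = Membershipₚ.∈-map⁻ S S v∈σfree
            d∈ds , ¬fix = Membershipₚ.∈-filter⁻ S (¬? ∘ fixed?) nonfixed-resp {xs = ds} d∈free
            -- `d` and `v` are equivalent members of `ds`, hence equal; as `v` is also `σ d`, this
            -- would make `d` fixed.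
            d≈v = Unique-∼⇒≈ ds-∼! d∈ds v∈ds (∼.trans (x∼σx d) (≈⇒∼ (≈-sym v≈σd)))
        in ¬fix (≈-trans d≈v v≈σd)

      to : ∀ {x} → x ∈ xs → x ∈ ds ++ map σ free
      to x∈xs with representative x∈xs
      ... | d , d∈ds , inj₁ x≈d = Membershipₚ.∈-++⁺ˡ S (Membershipₚ.∈-resp-≈ S (≈-sym x≈d) d∈ds)
      ... | d , d∈ds , inj₂ x≈σd with fixed? d
      ...   | yes d≈σd = Membershipₚ.∈-++⁺ˡ S (Membershipₚ.∈-resp-≈ S (≈-trans d≈σd (≈-sym x≈σd)) d∈ds)
      ...   | no  d≉σd = Membershipₚ.∈-++⁺ʳ S ds (Membershipₚ.∈-resp-≈ S (≈-sym x≈σd)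
                (Membershipₚ.∈-map⁺ S S σ-cong (Membershipₚ.∈-filter⁺ S (¬? ∘ fixed?) nonfixed-resp d∈ds d≉σd)))

      from : ∀ {x} → x ∈ ds ++ map σ free → x ∈ xs
      from x∈ with Membershipₚ.∈-++⁻ S ds x∈
      ... | inj₁ x∈ds = ds⊆xs x∈ds
      ... | inj₂ x∈σfree =
        let d , d∈free , x≈σd = Membershipₚ.∈-map⁻ S S x∈σfree
            d∈ds , _ = Membershipₚ.∈-filter⁻ S (¬? ∘ fixed?) nonfixed-resp {xs = ds} d∈free
        in Membershipₚ.∈-resp-≈ S (≈-sym x≈σd) (closed (ds⊆xs d∈ds))

    -- The class of a fixed element is that element alone up to `≈`, so its representative is the
    -- element itself.
    fixed-count : length (filter fixed? xs) ≡ length (filter fixed? ds)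
    fixed-count = Unique-⊆⊇⇒length≡ S (Unique.filter⁺ S fixed? xs!) (Unique.filter⁺ S fixed? ds!) to from
      where
      to : ∀ {x} → x ∈ filter fixed? xs → x ∈ filter fixed? ds
      to x∈ with Membershipₚ.∈-filter⁻ S fixed? fixed-resp {xs = xs} x∈
      ... | x∈xs , x≈σx with representative x∈xs
      ...   | d , d∈ds , inj₁ x≈d = Membershipₚ.∈-filter⁺ S fixed? fixed-resp
                (Membershipₚ.∈-resp-≈ S (≈-sym x≈d) d∈ds) x≈σx
      ...   | d , d∈ds , inj₂ x≈σd = Membershipₚ.∈-filter⁺ S fixed? fixed-resp
                (Membershipₚ.∈-resp-≈ S (σ-injective (≈-trans (≈-sym x≈σd) x≈σx)) d∈ds) x≈σx

      from : ∀ {x} → x ∈ filter fixed? ds → x ∈ filter fixed? xs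
      from x∈ = let x∈ds , x≈σx = Membershipₚ.∈-filter⁻ S fixed? fixed-resp {xs = ds} x∈
                in Membershipₚ.∈-filter⁺ S fixed? fixed-resp (ds⊆xs x∈ds) x≈σx

-- The enumeration of proper colourings.

-- Colourings are compared pointwise, so membership and uniqueness in lists of colourings are meant
-- up to `≗`.
colouringSetoid : Graph → ℕ → Setoid _ _
colouringSetoid Γ l = Fin (Graph.order Γ) →-setoid Fin l

module _ (Γ : Graph) {l : ℕ} (μ : ℕ) where
  private
    S = colouringSetoid Γ l
    open Membership S

  Proper-resp : ∀ {f g : Coloring Γ l} → f ≗ g → Proper Γ μ f → Proper Γ μ g
  Proper-resp f≗g proper v w v~w = Sum.map
    (λ fv≢fw gv≡gw → fv≢fw (trans (f≗g v) (trans gv≡gw (sym (f≗g w)))))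
    (λ (fv≡fw , big) → trans (sym (f≗g v)) (trans fv≡fw (f≗g w)) , subst (λ c → color c > μ) (f≗g v) big)
    (proper v w v~w)

  -- `funToFin` recovers the code of a colouring from its values, so different codes give pointwise
  -- different colourings.
  properColorings-! : Unique S (properColorings Γ l μ)
  properColorings-! = Unique.filter⁺ S (proper? Γ μ)
    (Unique.map⁺ (setoid _) S finToFun-injective (Unique.tabulate⁺ (setoid _) (λ eq → eq)))
    where
    funToFin-cong : ∀ {m n} {f g : Fin m → Fin n} → f ≗ g → Fin.funToFin f ≡ Fin.funToFin g
    funToFin-cong {zero}  f≗g = refl
    funToFin-cong {suc m} f≗g = cong₂ Fin.combine (f≗g zero) (funToFin-cong (f≗g ∘ suc))

    finToFun-injective : ∀ {m n} {i j : Fin (n ℕ.^ m)} → Fin.finToFun {n} {m} i ≗ Fin.finToFun j → i ≡ j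
    finToFun-injective {m} {n} {i} {j} eq = trans (sym (Fin.funToFin-finToFin {m} {n} i))
      (trans (funToFin-cong eq) (Fin.funToFin-finToFin {m} {n} j))

  -- The code `funToFin f` locates a colouring pointwise equal to `f` in the full enumeration.
  ∈-properColorings⁺ : ∀ {f} → Proper Γ μ f → f ∈ properColorings Γ l μ
  ∈-properColorings⁺ {f} proper = Membershipₚ.∈-filter⁺ S (proper? Γ μ) Proper-resp
    (Membershipₚ.∈-resp-≈ S (Fin.finToFun-funToFin f)
      (Membershipₚ.∈-map⁺ (setoid _) S (λ { refl _ → refl })
        (Membershipₚ.∈-tabulate⁺ (setoid _) (Fin.funToFin f))))
    proper

  ∈-properColorings⁻ : ∀ {f} → f ∈ properColorings Γ l μ → Proper Γ μ f
  ∈-properColorings⁻ f∈ = proj₂ (Membershipₚ.∈-filter⁻ S (proper? Γ μ) Proper-resp {xs = colorings Γ l} f∈)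

-- Automorphisms of a path.

-- A sequence with steps ±1 that never returns to its previous value cannot turn.

monotone-walk : ∀ n (q : Fin (suc n) → ℕ) → Injective _≡_ _≡_ q →
                (∀ i → q (suc i) ≡ suc (q (inject₁ i)) ⊎ q (inject₁ i) ≡ suc (q (suc i))) →
                (∀ i → q i ≡ q zero + toℕ i) ⊎ (∀ i → q i + toℕ i ≡ q zero)
monotone-walk zero    q q-inj step = inj₁ λ { zero → sym (ℕ.+-identityʳ _) }
monotone-walk (suc n) q q-inj step
  with step zero | monotone-walk n (q ∘ suc) (Fin.suc-injective ∘ q-inj) (step ∘ suc)
... | inj₁ up | inj₁ ups = inj₁ λ
  { zero    → sym (ℕ.+-identityʳ _)
  ; (suc i) → trans (ups i) (trans (cong (λ z → z + toℕ i) up) (sym (ℕ.+-suc _ _))) }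
... | inj₂ down | inj₂ downs = inj₂ λ
  { zero    → ℕ.+-identityʳ _
  ; (suc i) → trans (ℕ.+-suc _ _) (trans (cong suc (downs i)) (sym down)) }
-- With only two vertices the tail has no direction of its own, so the first step decides.
monotone-walk (suc zero) q q-inj step | inj₁ up | inj₂ downs = inj₁ λ
  { zero → sym (ℕ.+-identityʳ _) ; (suc zero) → trans up (sym (ℕ.+-comm _ 1)) }
monotone-walk (suc zero) q q-inj step | inj₂ down | inj₁ ups = inj₂ λ
  { zero → ℕ.+-identityʳ _ ; (suc zero) → trans (ℕ.+-comm _ 1) (sym down) }
-- A turn after the first step would give the vertices 0 and 2 the same value.
monotone-walk (suc (suc n)) q q-inj step | inj₁ up | inj₂ downs =
  contradiction (q-inj (ℕ.suc-injective (trans (sym up) (trans (sym (downs (suc zero))) (ℕ.+-comm _ 1))))) λ ()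
monotone-walk (suc (suc n)) q q-inj step | inj₂ down | inj₁ ups =
  contradiction (q-inj (trans down (sym (trans (ups (suc zero)) (ℕ.+-comm _ 1))))) λ ()

toℕ+toℕ-opposite : ∀ {n} (i : Fin (suc n)) → toℕ i + toℕ (opposite i) ≡ n
toℕ+toℕ-opposite i = trans (cong (λ z → toℕ i + z) (Fin.opposite-prop i)) (ℕ.m+[n∸m]≡n (Fin.toℕ≤pred[n] i))

-- Mirror images are recognised by an additive equation, which avoids truncated subtraction.
toℕ+toℕ≡n⇒opposite : ∀ {n} (i j : Fin (suc n)) → toℕ i + toℕ j ≡ n → j ≡ opposite i
toℕ+toℕ≡n⇒opposite i j eq = Fin.toℕ-injective
  (ℕ.+-cancelˡ-≡ (toℕ i) _ _ (trans eq (sym (toℕ+toℕ-opposite i))))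

-- The images of consecutive vertices are adjacent, so they form an injective walk with unit steps,
-- which is straight. Making `n` such steps between 0 and `n` forces it to start at 0 or at `n`.
path-automorphism : ∀ n (π : Permutation′ (suc n)) → IsAutomorphism (path n) π →
                    (∀ v → π ⟨$⟩ʳ v ≡ v) ⊎ (∀ v → π ⟨$⟩ʳ v ≡ opposite v)
path-automorphism n π aut = Sum.map ascending descending
  (monotone-walk n q (Injection.injective (↔⇒↣ π) ∘ Fin.toℕ-injective)
    (λ i → Equivalence.to (aut (inject₁ i) (suc i)) (inj₁ (cong suc (sym (Fin.toℕ-inject₁ i))))))
  where
  q : Fin (suc n) → ℕ
  q v = toℕ (π ⟨$⟩ʳ v)

  q≤n : ∀ v → q v ≤ n
  q≤n v = Fin.toℕ≤pred[n] (π ⟨$⟩ʳ v)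

  last : Fin (suc n)
  last = Fin.fromℕ n

  ascending : (∀ i → q i ≡ q zero + toℕ i) → ∀ v → π ⟨$⟩ʳ v ≡ v
  ascending up v = Fin.toℕ-injective (trans (up v) (cong (λ z → z + toℕ v) q0≡0))
    where
    q0≡0 : q zero ≡ 0
    q0≡0 = ℕ.n≤0⇒n≡0 (ℕ.+-cancelʳ-≤ n _ 0
      (subst (_≤ n) (trans (up last) (cong (λ z → q zero + z) (Fin.toℕ-fromℕ n))) (q≤n last)))

  descending : (∀ i → q i + toℕ i ≡ q zero) → ∀ v → π ⟨$⟩ʳ v ≡ opposite v
  descending down v = toℕ+toℕ≡n⇒opposite v (π ⟨$⟩ʳ v)
    (trans (ℕ.+-comm (toℕ v) _) (trans (down v) q0≡n))
    where
    q0≡n : q zero ≡ n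
    q0≡n = ℕ.≤-antisym (q≤n zero) (subst (_≤ q zero) (Fin.toℕ-fromℕ n)
      (subst (toℕ last ≤_) (down last) (ℕ.m≤n+m _ _)))

-- Reversal turns an ascending edge into a descending one, hence the swap.
opposite-Adj : ∀ n {v w} → Graph.Adj (path n) v w → Graph.Adj (path n) (opposite v) (opposite w)
opposite-Adj n {v} {w} = Sum.swap ∘ Sum.map flip-step flip-step
  where
  flip-step : ∀ {v w : Fin (suc n)} → toℕ w ≡ suc (toℕ v) → toℕ (opposite v) ≡ suc (toℕ (opposite w))
  flip-step {v} {w} eq = ℕ.+-cancelˡ-≡ (toℕ v) _ _ (begin
    toℕ v + toℕ (opposite v)       ≡⟨ toℕ+toℕ-opposite v ⟩
    n                              ≡⟨ toℕ+toℕ-opposite w ⟨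
    toℕ w + toℕ (opposite w)       ≡⟨ cong (λ z → z + toℕ (opposite w)) eq ⟩
    suc (toℕ v + toℕ (opposite w)) ≡⟨ ℕ.+-suc _ _ ⟨
    toℕ v + suc (toℕ (opposite w)) ∎)
    where open ≡-Reasoning

reverse-automorphism : ∀ n → IsAutomorphism (path n) Perm.reverse
reverse-automorphism n v w = mk⇔ (opposite-Adj n)
  (λ e → subst₂ (Graph.Adj (path n)) (Fin.opposite-involutive v) (Fin.opposite-involutive w) (opposite-Adj n e))

-- The orbit count for a path.

palindrome? : ∀ {n l} → Decidable₁ (λ (f : Fin n → Fin l) → f ≗ f ∘ opposite)
palindrome? f = Fin.all? λ v → f v Fin.≟ f (opposite v)

palindromes : ∀ n l μ → List (Coloring (path n) l)
palindromes n l μ = filter palindrome? (properColorings (path n) l μ)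

-- The involution is reversal, whose fixed colourings are the palindromes. For `n` equal to 0
-- reversal is the identity and every colouring is a palindrome, so the formula still counts
-- correctly.
path-orbit-count : ∀ n l μ → OP (path n) (Aut (path n)) l μ + OP (path n) (Aut (path n)) l μ
                               ≡ P (path n) l μ + length (palindromes n l μ)
path-orbit-count n l μ = InvolutionOrbits.orbit-count
  (Setoid.isEquivalence (colouringSetoid (path n) l))
  (isEquivalence (path n) (Aut (path n)) l) (equivalent? (path n) (Aut (path n)) l)
  (λ f → f ∘ opposite) (λ f≗g → f≗g ∘ opposite) (λ f v → cong f (Fin.opposite-involutive v))
  (λ f≗g → Perm.id , (λ v w → mk⇔ (λ e → e) (λ e → e)) , sym ∘ f≗g)
  (λ f → Perm.reverse , reverse-automorphism n , λ _ → refl)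
  (λ {f} (π , π∈ , eq) → Sum.map
    (λ π≈id v → trans (eq v) (cong f (π≈id v)))
    (λ π≈op v → trans (eq v) (cong f (π≈op v)))
    (path-automorphism n π π∈))
  palindrome?
  (properColorings-! (path n) μ)
  (λ f∈ → ∈-properColorings⁺ (path n) μ (reversed-proper (∈-properColorings⁻ (path n) μ f∈)))
  where
  reversed-proper : ∀ {f : Coloring (path n) l} → Proper (path n) μ f → Proper (path n) μ (f ∘ opposite)
  reversed-proper proper v w v~w = proper (opposite v) (opposite w) (opposite-Adj n v~w)

-- Folding a path about its middle.

-- A vertex of the path of length k + e + k with e ≤ 1 is folded to its distance
-- from the nearest middle vertex, where the middle vertices are k and k + e.
-- For e = 1 these two are adjacent and both folded to zero.

module Fold (k e : ℕ) (e≤1 : e ≤ 1) where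

  private
    n : ℕ
    n = k + e + k

  -- The distance as a relation: `v` lies `i` below `k` or `i` above `k + e`. The additive form
  -- allows arguments by cancellation.
  Folds : ℕ → ℕ → Set
  Folds v i = v + i ≡ k ⊎ v ≡ k + e + i

  -- At most one of the two truncated differences is non-zero, so the sum is the distance on either
  -- side.
  foldℕ : ℕ → ℕ
  foldℕ v = (k ∸ v) + (v ∸ (k + e))

  foldℕ-folds : ∀ v → Folds v (foldℕ v)
  foldℕ-folds v with ℕ.≤-<-connex v k
  ... | inj₁ v≤k = inj₁ (begin
    v + ((k ∸ v) + (v ∸ (k + e))) ≡⟨ cong (λ z → v + ((k ∸ v) + z)) (ℕ.m≤n⇒m∸n≡0 (ℕ.≤-trans v≤k (ℕ.m≤m+n k e))) ⟩
    v + ((k ∸ v) + 0)             ≡⟨ cong (λ z → v + z) (ℕ.+-identityʳ _) ⟩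
    v + (k ∸ v)                   ≡⟨ ℕ.m+[n∸m]≡n v≤k ⟩
    k                             ∎)
    where open ≡-Reasoning
  ... | inj₂ k<v = inj₂ (begin
    v                                 ≡⟨ ℕ.m+[n∸m]≡n k+e≤v ⟨
    k + e + (v ∸ (k + e))             ≡⟨ cong (λ z → k + e + (z + (v ∸ (k + e)))) (ℕ.m≤n⇒m∸n≡0 (ℕ.<⇒≤ k<v)) ⟨
    k + e + ((k ∸ v) + (v ∸ (k + e))) ∎)
    where
    open ≡-Reasoning
    -- As `e` is at most 1, no position lies strictly between `k` and `k + e`.
    k+e≤v : k + e ≤ v
    k+e≤v = ℕ.≤-trans (ℕ.+-monoʳ-≤ k e≤1) (subst (_≤ v) (ℕ.+-comm 1 k) k<v)

  Folds-bound : ∀ {v i} → v ≤ n → Folds v i → i ≤ k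
  Folds-bound _   (inj₁ eq) = subst (_ ≤_) eq (ℕ.m≤n+m _ _)
  Folds-bound v≤n (inj₂ eq) = ℕ.+-cancelˡ-≤ (k + e) _ k (subst (_≤ n) eq v≤n)

  fold-bound : (v : Fin (suc n)) → foldℕ (toℕ v) < suc k
  fold-bound v = s≤s (Folds-bound (Fin.toℕ≤pred[n] v) (foldℕ-folds (toℕ v)))

  fold : Fin (suc n) → Fin (suc k)
  fold v = Fin.fromℕ< (fold-bound v)

  fold-folds : ∀ v → Folds (toℕ v) (toℕ (fold v))
  fold-folds v = subst (Folds (toℕ v)) (sym (Fin.toℕ-fromℕ< (fold-bound v))) (foldℕ-folds (toℕ v))

  unfold-bound : (i : Fin (suc k)) → k + e + toℕ i < suc n
  unfold-bound i = s≤s (ℕ.+-monoʳ-≤ (k + e) (Fin.toℕ≤pred[n] i))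

  unfold : Fin (suc k) → Fin (suc n)
  unfold i = Fin.fromℕ< (unfold-bound i)

  toℕ-unfold : ∀ i → toℕ (unfold i) ≡ k + e + toℕ i
  toℕ-unfold i = Fin.toℕ-fromℕ< (unfold-bound i)

  -- If the two descriptions of `v` differ, then `v` is at most `k` and at least `k + e`, which
  -- forces both distances to be 0.
  Folds-functional : ∀ {v i j} → Folds v i → Folds v j → i ≡ j
  Folds-functional (inj₁ p) (inj₁ q) = ℕ.+-cancelˡ-≡ _ _ _ (trans p (sym q))
  Folds-functional (inj₂ p) (inj₂ q) = ℕ.+-cancelˡ-≡ (k + e) _ _ (trans (sym p) q)
  Folds-functional (inj₁ p) (inj₂ q) = crossing p q
    where
    crossing : ∀ {v i j} → v + i ≡ k → v ≡ k + e + j → i ≡ j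
    crossing {v} {i} {j} p q = trans (ℕ.m+n≡0⇒n≡0 (e + j) e+j+i≡0) (sym (ℕ.m+n≡0⇒n≡0 e (ℕ.m+n≡0⇒m≡0 (e + j) e+j+i≡0)))
      where
      reassociate : ∀ k e j i → k + (e + j + i) ≡ k + e + j + i
      reassociate = solve-∀
      e+j+i≡0 : e + j + i ≡ 0
      e+j+i≡0 = ℕ.+-cancelˡ-≡ k _ 0 (trans (reassociate k e j i)
        (trans (cong (λ z → z + i) (sym q)) (trans p (sym (ℕ.+-identityʳ k)))))
  Folds-functional p@(inj₂ _) q@(inj₁ _) = sym (Folds-functional q p)

  fold-unfold : ∀ i → fold (unfold i) ≡ i
  fold-unfold i = Fin.toℕ-injective (Folds-functional (fold-folds (unfold i)) (inj₂ (toℕ-unfold i)))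

  -- Reflection exchanges the two halves and keeps the distance from the middle.
  Folds-opposite : ∀ {v w i} → v + w ≡ n → Folds v i → Folds w i
  Folds-opposite {v} {w} {i} v+w≡n (inj₁ v+i≡k) = inj₂ (ℕ.+-cancelˡ-≡ v _ _
    (trans v+w≡n (trans (cong (λ z → k + e + z) (sym v+i≡k)) (exchange k e v i))))
    where
    exchange : ∀ k e v i → k + e + (v + i) ≡ v + (k + e + i)
    exchange = solve-∀
  Folds-opposite {v} {w} {i} v+w≡n (inj₂ refl) = inj₁ (ℕ.+-cancelˡ-≡ (k + e) _ _
    (trans (exchange (k + e) w i) v+w≡n))
    where
    exchange : ∀ m w i → m + (w + i) ≡ m + i + w
    exchange = solve-∀

  fold-opposite : ∀ v → fold (opposite v) ≡ fold v
  fold-opposite v = Fin.toℕ-injective (Folds-functional (fold-folds (opposite v))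
    (Folds-opposite (toℕ+toℕ-opposite v) (fold-folds v)))

  -- `unfold` lands in the upper half: vertices there return to themselves, those of the lower half
  -- become their mirror images.
  unfold-fold : ∀ v → unfold (fold v) ≡ v ⊎ unfold (fold v) ≡ opposite v
  unfold-fold v with fold-folds v
  ... | inj₂ eq = inj₁ (Fin.toℕ-injective (trans (toℕ-unfold (fold v)) (sym eq)))
  ... | inj₁ eq = inj₂ (toℕ+toℕ≡n⇒opposite v _ (trans (cong (λ z → toℕ v + z) (toℕ-unfold (fold v)))
    (trans (exchange (toℕ v) k e (toℕ (fold v))) (cong (λ z → k + e + z) eq))))
    where
    exchange : ∀ v k e i → v + (k + e + i) ≡ k + e + (v + i)
    exchange = solve-∀

  -- A step inside one half changes the distance by one. A step from the lower to the upper half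
  -- gives `e + j + i ≡ 1`, so exactly one summand is 1; if it is `e`, the step is the edge between
  -- the two middle vertices.
  Folds-suc : ∀ {v i j} → Folds v i → Folds (suc v) j →
              (j ≡ suc i ⊎ i ≡ suc j) ⊎ (e ≡ 1 × i ≡ 0 × j ≡ 0)
  Folds-suc (inj₁ p) (inj₁ q) = inj₁ (inj₂ (ℕ.+-cancelˡ-≡ _ _ _ (trans p (trans (sym q) (sym (ℕ.+-suc _ _))))))
  Folds-suc (inj₂ p) (inj₂ q) = inj₁ (inj₁ (ℕ.+-cancelˡ-≡ (k + e) _ _ (trans (sym q) (trans (cong suc p) (sym (ℕ.+-suc (k + e) _))))))
  Folds-suc {v} {i} {j} (inj₁ p) (inj₂ q) = cases e i j e+j+i≡1
    where
    reassociate : ∀ k e j i → k + (e + j + i) ≡ k + e + j + i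
    reassociate = solve-∀
    e+j+i≡1 : e + j + i ≡ 1
    e+j+i≡1 = ℕ.+-cancelˡ-≡ k _ 1 (trans (reassociate k e j i)
      (trans (cong (λ z → z + i) (sym q)) (trans (cong suc p) (ℕ.+-comm 1 k))))
    cases : ∀ e i j → e + j + i ≡ 1 → (j ≡ suc i ⊎ i ≡ suc j) ⊎ (e ≡ 1 × i ≡ 0 × j ≡ 0)
    cases zero    .1   zero    refl = inj₁ (inj₂ refl)
    cases zero    zero (suc zero) refl = inj₁ (inj₁ refl)
    cases (suc zero) zero zero refl = inj₂ (refl , refl , refl)
  -- An ascending step cannot lead from the upper half to the lower one.
  Folds-suc {v} {i} {j} (inj₂ p) (inj₁ q) = contradiction (ℕ.+-cancelˡ-≡ k _ 0 (trans (reassociate k e i j)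
      (trans (cong (λ z → suc z + j) (sym p)) (trans q (sym (ℕ.+-identityʳ k)))))) λ ()
    where
    reassociate : ∀ k e i j → k + suc (e + i + j) ≡ suc (k + e + i) + j
    reassociate = solve-∀

  fold-Adj : ∀ {v w} → Graph.Adj (path n) v w →
             Graph.Adj (path k) (fold v) (fold w) ⊎ (e ≡ 1 × fold v ≡ zero × fold w ≡ zero)
  fold-Adj = [ ascending , Sum.map Sum.swap (λ (e≡1 , w≡0 , v≡0) → e≡1 , v≡0 , w≡0) ∘ ascending ]′
    where
    ascending : ∀ {v w : Fin (suc n)} → toℕ w ≡ suc (toℕ v) →
                Graph.Adj (path k) (fold v) (fold w) ⊎ (e ≡ 1 × fold v ≡ zero × fold w ≡ zero)
    ascending {v} {w} eq = Sum.map₂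
      (λ (e≡1 , v≡0 , w≡0) → e≡1 , Fin.toℕ-injective v≡0 , Fin.toℕ-injective w≡0)
      (Folds-suc (fold-folds v) (subst (λ z → Folds z (toℕ (fold w))) eq (fold-folds w)))

  unfold-Adj : ∀ {i j} → Graph.Adj (path k) i j → Graph.Adj (path n) (unfold i) (unfold j)
  unfold-Adj = Sum.map ascending ascending
    where
    ascending : ∀ {i j : Fin (suc k)} → toℕ j ≡ suc (toℕ i) → toℕ (unfold j) ≡ suc (toℕ (unfold i))
    ascending {i} {j} eq = begin
      toℕ (unfold j)        ≡⟨ toℕ-unfold j ⟩
      k + e + toℕ j         ≡⟨ cong (λ z → k + e + z) eq ⟩
      k + e + suc (toℕ i)   ≡⟨ ℕ.+-suc (k + e) (toℕ i) ⟩
      suc (k + e + toℕ i)   ≡⟨ cong suc (toℕ-unfold i) ⟨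
      suc (toℕ (unfold i))  ∎
      where open ≡-Reasoning

  -- Here `unfold zero` is the vertex `k + 1`, and its mirror image is `k`.
  middle-Adj : e ≡ 1 → Graph.Adj (path n) (opposite (unfold zero)) (unfold zero)
  middle-Adj e≡1 = inj₁ (ℕ.+-cancelʳ-≡ k _ _ (begin
    toℕ (unfold zero) + k         ≡⟨ cong (λ z → z + k) u≡k+1 ⟩
    k + 1 + k                     ≡⟨ cong (λ z → k + z + k) e≡1 ⟨
    k + e + k                     ≡⟨ toℕ+toℕ-opposite (unfold zero) ⟨
    toℕ (unfold zero) + o         ≡⟨ cong (λ z → z + o) u≡k+1 ⟩
    k + 1 + o                     ≡⟨ exchange k o ⟩
    suc o + k                     ∎))
    where
    open ≡-Reasoning
    o : ℕ
    o = toℕ (opposite (unfold zero))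
    u≡k+1 : toℕ (unfold zero) ≡ k + 1
    u≡k+1 = trans (toℕ-unfold zero) (trans (ℕ.+-identityʳ (k + e)) (cong (λ z → k + z) e≡1))
    exchange : ∀ k o → k + 1 + o ≡ suc o + k
    exchange = solve-∀

  module _ {l : ℕ} (μ : ℕ) where

    -- The second component stands for the middle edge, which folding collapses to the vertex
    -- `zero`: its ends share a colour.
    ProperHalf : Coloring (path k) l → Set
    ProperHalf g = Proper (path k) μ g × (e ≡ 1 → color (g zero) > μ)

    unfold-proper : ∀ {g} → ProperHalf g → Proper (path n) μ (g ∘ fold)
    unfold-proper {g} (proper , middle) v w v~w with fold-Adj v~w
    ... | inj₁ fv~fw = proper (fold v) (fold w) fv~fw
    ... | inj₂ (e≡1 , fv≡0 , fw≡0) = inj₂ (cong g (trans fv≡0 (sym fw≡0)) ,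
      subst (λ i → color (g i) > μ) (sym fv≡0) (middle e≡1))

    palindrome-folds : ∀ {f : Coloring (path n) l} → f ≗ f ∘ opposite → f ≗ f ∘ unfold ∘ fold
    palindrome-folds {f} f-pal v with unfold-fold v
    ... | inj₁ eq = cong f (sym eq)
    ... | inj₂ eq = trans (f-pal v) (cong f (sym eq))

    half-proper : ∀ {f : Coloring (path n) l} → f ≗ f ∘ opposite → Proper (path n) μ f → ProperHalf (f ∘ unfold)
    half-proper {f} f-pal proper = (λ i j i~j → proper (unfold i) (unfold j) (unfold-Adj i~j)) , λ e≡1 →
      -- The ends of the middle edge are mirror images, so only the equal-colour alternative of
      -- properness is left.
      [ (λ fo≢fu → contradiction (sym (f-pal (unfold zero))) fo≢fu)
      , (λ (fo≡fu , big) → subst (λ c → color c > μ) fo≡fu big)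
      ]′ (proper _ _ (middle-Adj e≡1))

    -- Composing with `fold` and with `unfold` gives inverse bijections between proper halves and
    -- proper palindromes. The enumeration `gs` of the halves is arbitrary because the two parities
    -- list them differently.
    palindromes-count : ∀ {gs : List (Coloring (path k) l)} (let open Membership (colouringSetoid (path k) l)) →
                        Unique (colouringSetoid (path k) l) gs →
                        (∀ {g} → g ∈ gs → ProperHalf g) → (∀ {g} → ProperHalf g → g ∈ gs) →
                        length (palindromes n l μ) ≡ length gs
    palindromes-count {gs} gs! sound complete = trans
      (Unique-⊆⊇⇒length≡ S (Unique.filter⁺ S palindrome? (properColorings-! (path n) μ))
        (Unique.map⁺ H S fold-injective gs!) to from)
      (length-map (_∘ fold) gs)
      where
      S H : Setoid _ _
      S = colouringSetoid (path n) l
      H = colouringSetoid (path k) l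

      open Membership S

      palindrome-resp : ∀ {f g : Coloring (path n) l} → f ≗ g → f ≗ f ∘ opposite → g ≗ g ∘ opposite
      palindrome-resp f≗g f-pal v = trans (sym (f≗g v)) (trans (f-pal v) (f≗g (opposite v)))

      fold-injective : ∀ {g h : Coloring (path k) l} → g ∘ fold ≗ h ∘ fold → g ≗ h
      fold-injective {g} {h} eq i = trans (cong g (sym (fold-unfold i)))
        (trans (eq (unfold i)) (cong h (fold-unfold i)))

      to : ∀ {f} → f ∈ palindromes n l μ → f ∈ map (_∘ fold) gs
      to {f} f∈ =
        let f∈proper , f-pal = Membershipₚ.∈-filter⁻ S palindrome? palindrome-resp {xs = properColorings (path n) l μ} f∈
        in Membershipₚ.∈-resp-≈ S {x = f ∘ unfold ∘ fold} (λ v → sym (palindrome-folds f-pal v))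
             (Membershipₚ.∈-map⁺ H S (λ eq → eq ∘ fold)
               (complete (half-proper f-pal (∈-properColorings⁻ (path n) μ f∈proper))))

      from : ∀ {f} → f ∈ map (_∘ fold) gs → f ∈ palindromes n l μ
      from f∈ =
        let g , g∈ , f≗g∘fold = Membershipₚ.∈-map⁻ H S f∈
        in Membershipₚ.∈-resp-≈ S {x = g ∘ fold} (λ v → sym (f≗g∘fold v))
             (Membershipₚ.∈-filter⁺ S palindrome? palindrome-resp
               (∈-properColorings⁺ (path n) μ (unfold-proper (sound g∈)))
               (λ v → cong g (sym (fold-opposite v))))

-- Halves of palindromes, by parity.

-- This serves to index by `Fin m` those of the `μ + m` colours that exceed `μ`.
↑ʳ-surjective : ∀ m {n} (i : Fin (m + n)) → m ≤ toℕ i → ∃[ j ] m Fin.↑ʳ j ≡ i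
↑ʳ-surjective zero    i       _         = i , refl
↑ʳ-surjective (suc m) (suc i) (s≤s m≤i) = let j , eq = ↑ʳ-surjective m i m≤i in j , cong suc eq

-- Colours above μ constrain nothing, so the end of a path can be coloured with
-- them freely, whatever the colouring of the rest Γ.

module _ (Γ : Graph) (μ m : ℕ)
         (Adj-suc : ∀ {v w} → Graph.Adj Γ v w ⇔ Graph.Adj (path (Graph.order Γ)) (suc v) (suc w)) where

  private
    k : ℕ
    k = Graph.order Γ

    H T : Setoid _ _
    H = colouringSetoid (path k) (μ + m)
    T = colouringSetoid Γ (μ + m)

    open Membership H

  extend : Fin m → Coloring Γ (μ + m) → Coloring (path k) (μ + m)
  extend c h = (μ Fin.↑ʳ c) Vector.∷ h

  extensions : List (Coloring (path k) (μ + m))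
  extensions = cartesianProductWith extend (allFin m) (properColorings Γ (μ + m) μ)

  length-extensions : length extensions ≡ m * P Γ (μ + m) μ
  length-extensions = trans (length-cartesianProductWith extend (allFin m) (properColorings Γ (μ + m) μ))
    (cong (λ z → z * P Γ (μ + m) μ) (length-tabulate {n = m} (λ i → i)))

  extensions-! : Unique H extensions
  extensions-! = Unique.cartesianProductWith⁺ (setoid _) T H extend
    (λ eq → Fin.↑ʳ-injective μ _ _ (eq zero) , eq ∘ suc)
    (Unique.tabulate⁺ (setoid _) (λ eq → eq)) (properColorings-! Γ μ)

  extend-big : (c : Fin m) → color (μ Fin.↑ʳ c) > μ
  -- `color` adds one, so exceeding `μ` means that the underlying index is at least `μ`.
  extend-big c = s≤s (subst (μ ≤_) (sym (Fin.toℕ-↑ʳ μ c)) (ℕ.m≤m+n μ _))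

  extend-proper : ∀ c {h} → Proper Γ μ h → Proper (path k) μ (extend c h)
  extend-proper c {h} proper (suc v) (suc w) v~w = proper v w (Equivalence.from Adj-suc v~w)
  extend-proper c {h} proper zero w _ with extend c h zero Fin.≟ extend c h w
  ... | yes eq = inj₂ (eq , extend-big c)
  ... | no neq = inj₁ neq
  extend-proper c {h} proper (suc v) zero _ with h v Fin.≟ μ Fin.↑ʳ c
  ... | yes eq = inj₂ (eq , subst (λ c → color c > μ) (sym eq) (extend-big c))
  ... | no neq = inj₁ neq

  ∈-extensions⁻ : ∀ {g} → g ∈ extensions → Proper (path k) μ g × color (g zero) > μ
  ∈-extensions⁻ g∈ =
    let c , h , _ , h∈ , g≗ = Membershipₚ.∈-cartesianProductWith⁻ (setoid _) T H extend (allFin m) _ g∈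
    in Proper-resp (path k) μ (sym ∘ g≗) (extend-proper c (∈-properColorings⁻ Γ μ h∈)) ,
       subst (λ c → color c > μ) (sym (g≗ zero)) (extend-big c)

  ∈-extensions⁺ : ∀ {g} → Proper (path k) μ g → color (g zero) > μ → g ∈ extensions
  ∈-extensions⁺ {g} proper (s≤s μ≤g0) =
    let c , μ↑c≡g0 = ↑ʳ-surjective μ (g zero) μ≤g0
    in Membershipₚ.∈-resp-≈ H {x = extend c (g ∘ suc)} (λ { zero → μ↑c≡g0 ; (suc v) → refl })
         (Membershipₚ.∈-cartesianProductWith⁺ (setoid _) T H extend-cong
           (Membershipₚ.∈-tabulate⁺ (setoid _) c)
           (∈-properColorings⁺ Γ μ λ v w v~w → proper (suc v) (suc w) (Equivalence.to Adj-suc v~w)))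
    where
    extend-cong : ∀ {c d h j} → c ≡ d → h ≗ j → extend c h ≗ extend d j
    extend-cong c≡d h≗j zero    = cong (μ Fin.↑ʳ_) c≡d
    extend-cong c≡d h≗j (suc v) = h≗j v

  -- The vertex `zero` of the half carries one of the `m` colours above `μ`, and removing it leaves
  -- `Γ`. Keeping `Γ` abstract covers both a path and the empty graph.
  odd-palindromes-count : length (palindromes (k + 1 + k) (μ + m) μ) ≡ m * P Γ (μ + m) μ
  odd-palindromes-count = trans
    (Fold.palindromes-count k 1 (s≤s z≤n) μ extensions-!
      (λ g∈ → let proper , big = ∈-extensions⁻ g∈ in proper , λ _ → big)
      (λ (proper , big) → ∈-extensions⁺ proper (big refl)))
    length-extensions

-- With a single middle vertex no edge collapses, so the extra condition on halves is vacuous.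
even-palindromes-count : ∀ k l μ → length (palindromes (k + 0 + k) l μ) ≡ P (path k) l μ
even-palindromes-count k l μ = Fold.palindromes-count k 0 z≤n {l} μ (properColorings-! (path k) μ)
  (λ g∈ → ∈-properColorings⁻ (path k) μ g∈ , λ ())
  (λ (proper , _) → ∈-properColorings⁺ (path k) μ proper)

path-Adj-suc : ∀ {j} {v w : Fin (suc j)} → Graph.Adj (path j) v w ⇔ Graph.Adj (path (suc j)) (suc v) (suc w)
path-Adj-suc = mk⇔ (Sum.map (cong suc) (cong suc)) (Sum.map ℕ.suc-injective ℕ.suc-injective)

-- Passage to the rationals.

-- Sums and products are compared through unnormalised fractions, where they compute; the 0 in
-- `mkℚᵘ` is the denominator 1 less one.
fromℕ-≃ : ∀ a → ℚ.toℚᵘ (fromℕ a) ℚᵘ.≃ ℚᵘ.mkℚᵘ (+ a) 0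
fromℕ-≃ a = ℚ.toℚᵘ-fromℚᵘ (ℚᵘ.mkℚᵘ (+ a) 0)

fromℕ-+ : ∀ a b → fromℕ (a + b) ≡ fromℕ a ℚ.+ fromℕ b
fromℕ-+ a b = ℚ.toℚᵘ-injective (begin
  ℚ.toℚᵘ (fromℕ (a + b))                          ≈⟨ fromℕ-≃ (a + b) ⟩
  ℚᵘ.mkℚᵘ (+ (a + b)) 0                           ≈⟨ ℚᵘ.*≡* (cong (ℤ._* + 1) (sym (cong₂ ℤ._+_ (ℤ.*-identityʳ (+ a)) (ℤ.*-identityʳ (+ b))))) ⟩
  ℚᵘ.mkℚᵘ (+ a) 0 ℚᵘ.+ ℚᵘ.mkℚᵘ (+ b) 0            ≈⟨ ℚᵘ.+-cong (fromℕ-≃ a) (fromℕ-≃ b) ⟨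
  ℚ.toℚᵘ (fromℕ a) ℚᵘ.+ ℚ.toℚᵘ (fromℕ b)          ≈⟨ ℚ.toℚᵘ-homo-+ (fromℕ a) (fromℕ b) ⟨
  ℚ.toℚᵘ (fromℕ a ℚ.+ fromℕ b)                    ∎)
  where open ℚᵘ.≃-Reasoning

fromℕ-* : ∀ a b → fromℕ (a * b) ≡ fromℕ a ℚ.* fromℕ b
fromℕ-* a b = ℚ.toℚᵘ-injective (begin
  ℚ.toℚᵘ (fromℕ (a * b))                          ≈⟨ fromℕ-≃ (a * b) ⟩
  ℚᵘ.mkℚᵘ (+ (a * b)) 0                           ≈⟨ ℚᵘ.*≡* (cong (ℤ._* + 1) (ℤ.pos-* a b)) ⟩
  ℚᵘ.mkℚᵘ (+ a) 0 ℚᵘ.* ℚᵘ.mkℚᵘ (+ b) 0            ≈⟨ ℚᵘ.*-cong (fromℕ-≃ a) (fromℕ-≃ b) ⟨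
  ℚ.toℚᵘ (fromℕ a) ℚᵘ.* ℚ.toℚᵘ (fromℕ b)          ≈⟨ ℚ.toℚᵘ-homo-* (fromℕ a) (fromℕ b) ⟨
  ℚ.toℚᵘ (fromℕ a ℚ.* fromℕ b)                    ∎)
  where open ℚᵘ.≃-Reasoning

-- The counting takes place in ℕ with the number of classes doubled; the division by two happens
-- only here.
fromℕ-half : ∀ a b c → a + a ≡ b + c → fromℕ a ≡ ½ ℚ.* (fromℕ b ℚ.+ fromℕ c)
fromℕ-half a b c a+a≡b+c = begin
  fromℕ a                            ≡⟨ ℚ.*-identityˡ (fromℕ a) ⟨
  (½ ℚ.+ ½) ℚ.* fromℕ a              ≡⟨ ℚ.*-distribʳ-+ (fromℕ a) ½ ½ ⟩
  ½ ℚ.* fromℕ a ℚ.+ ½ ℚ.* fromℕ a    ≡⟨ ℚ.*-distribˡ-+ ½ (fromℕ a) (fromℕ a) ⟨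
  ½ ℚ.* (fromℕ a ℚ.+ fromℕ a)        ≡⟨ cong (½ ℚ.*_) (fromℕ-+ a a) ⟨
  ½ ℚ.* fromℕ (a + a)                ≡⟨ cong (λ z → ½ ℚ.* fromℕ z) a+a≡b+c ⟩
  ½ ℚ.* fromℕ (b + c)                ≡⟨ cong (½ ℚ.*_) (fromℕ-+ b c) ⟩
  ½ ℚ.* (fromℕ b ℚ.+ fromℕ c)        ∎
  where open ≡-Reasoning

fromℕ-half-* : ∀ a b c d → a + a ≡ b + c * d → fromℕ a ≡ ½ ℚ.* (fromℕ b ℚ.+ fromℕ c ℚ.* fromℕ d)
fromℕ-half-* a b c d eq = trans (fromℕ-half a b (c * d) eq)
  (cong (λ z → ½ ℚ.* (fromℕ b ℚ.+ z)) (fromℕ-* c d))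

-- Parity and the lengths of the shorter paths.

+[j*2]/2≡+j : ∀ j → + (j * 2) ℤ./ + 2 ≡ + j
+[j*2]/2≡+j j = trans (ℤ.div-pos-is-/ℕ (+ (j * 2)) 2) (cong +_ (ℕ.m*n/n≡m j 2))

-- The shape `k + e + k` is the length treated in `Fold`, with `e` equal to 0 here and to 1 in
-- `odd-form`.
even-form : ∀ {n} → 2 ∣ n → ∃[ k ] n ≡ k + 0 + k
even-form (divides k eq) = k , trans eq (double k)
  where
  double : ∀ k → k * 2 ≡ k + 0 + k
  double = solve-∀

odd-form : ∀ n → ¬ 2 ∣ n → ∃[ k ] n ≡ k + 1 + k
odd-form zero          2∤n = contradiction (divides 0 refl) 2∤n
odd-form (suc zero)    2∤n = 0 , refl
odd-form (suc (suc n)) 2∤n =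
  let k , eq = odd-form n λ (divides q eq) → 2∤n (divides (suc q) (cong (λ z → suc (suc z)) eq))
  in suc k , trans (cong (λ z → suc (suc z)) eq) (cong suc (sym (ℕ.+-suc (k + 1) k)))

even-rest : ∀ k → + (k + 0 + k) ℤ./ + 2 ≡ + k
even-rest k = trans (cong (λ z → + z ℤ./ + 2) (normal k)) (+[j*2]/2≡+j k)
  where
  normal : ∀ k → k + 0 + k ≡ k * 2
  normal = solve-∀

odd-rest : ∀ j → (+ (suc j + 1 + suc j) - + 3) ℤ./ + 2 ≡ + j
odd-rest j = trans (cong (λ z → (+ z - + 3) ℤ./ + 2) (normal j)) (+[j*2]/2≡+j j)
  where
  normal : ∀ j → suc j + 1 + suc j ≡ 3 + j * 2
  normal = solve-∀

-- The two counts over ℕ.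

-- Stated as predicates so that `n` can be replaced by `k + e + k`, and `l` by `μ + m`, through
-- `subst`.
EvenCount OddCount : (n l μ : ℕ) → Set
EvenCount n l μ = OP (Π (+ n)) (Aut (Π (+ n))) l μ + OP (Π (+ n)) (Aut (Π (+ n))) l μ
                    ≡ P (Π (+ n)) l μ + P (Π (+ n ℤ./ + 2)) l μ
OddCount n l μ = OP (Π (+ n)) (Aut (Π (+ n))) l μ + OP (Π (+ n)) (Aut (Π (+ n))) l μ
                   ≡ P (Π (+ n)) l μ + (l ∸ μ) * P (Π ((+ n - + 3) ℤ./ + 2)) l μ

even-count : ∀ {n} l μ → 2 ∣ n → EvenCount n l μ
even-count l μ 2∣n = let k , n≡ = even-form 2∣n in subst (λ n → EvenCount n l μ) (sym n≡) (count k)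
  where
  count : ∀ k → EvenCount (k + 0 + k) l μ
  count k = trans (path-orbit-count (k + 0 + k) l μ)
    (cong (λ z → P (path (k + 0 + k)) l μ + z)
      (trans (even-palindromes-count k l μ) (cong (λ i → P (Π i) l μ) (sym (even-rest k)))))

odd-count : ∀ {n l μ} → μ ≤ l → ¬ (2 ∣ n) → OddCount n l μ
odd-count {n} {l} {μ} μ≤l 2∤n =
  let k , n≡ = odd-form n 2∤n
      m , l≡ = ℕ.m≤n⇒∃[o]m+o≡n μ≤l
  in subst (λ n → OddCount n l μ) (sym n≡) (subst (λ l → OddCount (k + 1 + k) l μ) l≡ (count k m))
  where
  palindromes-count : ∀ k m → length (palindromes (k + 1 + k) (μ + m) μ)
                                ≡ m * P (Π ((+ (k + 1 + k) - + 3) ℤ./ + 2)) (μ + m) μ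
  -- Here `n` is 1 and the index `(1 - 3) / 2` evaluates to -1, so the rest is the empty graph and
  -- its adjacency condition is vacuous.
  palindromes-count zero    m = odd-palindromes-count emptyGraph μ m λ { {()} }
  palindromes-count (suc j) m = trans (odd-palindromes-count (path j) μ m path-Adj-suc)
    (cong (λ i → m * P (Π i) (μ + m) μ) (sym (odd-rest j)))

  count : ∀ k m → OddCount (k + 1 + k) (μ + m) μ
  count k m = trans (path-orbit-count (k + 1 + k) (μ + m) μ)
    (cong (λ z → P (path (k + 1 + k)) (μ + m) μ + z)
      (trans (palindromes-count k m)
        (cong (λ c → c * P (Π ((+ (k + 1 + k) - + 3) ℤ./ + 2)) (μ + m) μ) (sym (ℕ.m+n∸m≡n μ m)))))

theorem9 : ∀ (n l μ : ℕ) → 1 ≤ l → μ ≤ l →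
    (2 ∣ n →
    fromℕ (OP (Π (+ n)) (Aut (Π (+ n))) l μ)
    ≡ ½ ℚ.* (fromℕ (P (Π (+ n)) l μ) ℚ.+ fromℕ (P (Π (+ n ℤ./ + 2)) l μ)))
    × (¬ (2 ∣ n) →
    fromℕ (OP (Π (+ n)) (Aut (Π (+ n))) l μ)
    ≡ ½ ℚ.* (fromℕ (P (Π (+ n)) l μ) ℚ.+ fromℕ (l ∸ μ) ℚ.* fromℕ (P (Π ((+ n - + 3) ℤ./ + 2)) l μ)))
theorem9 n l μ _ μ≤l =
  (λ 2∣n → fromℕ-half (OP (Π (+ n)) (Aut (Π (+ n))) l μ) (P (Π (+ n)) l μ) (P (Π (+ n ℤ./ + 2)) l μ)
    (even-count l μ 2∣n)) ,
  (λ 2∤n → fromℕ-half-* (OP (Π (+ n)) (Aut (Π (+ n))) l μ) (P (Π (+ n)) l μ)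
    (l ∸ μ) (P (Π ((+ n - + 3) ℤ./ + 2)) l μ) (odd-count μ≤l 2∤n))
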